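{- For every variable $x\in V$ and every command $c\in\mathcal C$, $$(\mathbf{var}\,x\cdot c)=(\mathbf{var}\,x\cdot c)\Cap\mathbf{guar}\,\mathrm{id}(x).$$
   Context: Commands. $(\mathcal C,\le,\bigwedge,\bigsqcup,\bot,\top)$ is a complete distributive lattice (with arbitrary meet $\bigwedge$, binary meet $\sqcap$, arbitrary join $\bigsqcup$ and binary join $\sqcup$) whose elements are called commands. It has an associative sequential composition $;$ with identity $\mathbf{nil}$, monotone in both arguments, and an associative, commutative, idempotent, monotone weak conjunction $\Cap$. Iterations: $c^\star$ (resp. $c^\omega$) is the least (resp. greatest) fixed point of $y\mapsto\mathbf{nil}\sqcup c;y$. States and relations. $V$ is a countable set of variables, $S$ a set, $\Sigma$ the set of partial functions $V\rightharpoonup S$. $\mathrm{id}(x)$ relates $\sigma,\sigma'\in\Sigma$ iff they agree on the variable $x$; $\mathrm{id}$ is the identity relation on $\Sigma$. Primitive commands. $\pi,\epsilon:\mathcal P(\Sigma\times\Sigma)\to\mathcal A$ (program and environment steps) are injective homomorphisms of complete Boolean algebras onto complete Boolean sub-algebras of $\mathcal C$, where $\mathcal A\subseteq\mathcal C$ is the complete Boolean sub-algebra of atomic steps. $\boldsymbol\pi=\pi(\Sigma\times\Sigma)$ and $\boldsymbol\epsilon=\epsilon(\Sigma\times\Sigma)$ are complementary in $\mathcal A$; $\boldsymbol\alpha=\boldsymbol\pi\sqcup\boldsymbol\epsilon$. $\mathbf{chaos}=\boldsymbol\alpha^\omega$ is the identity of $\Cap$. Localisation. For each $x\in V$ there is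 a unary operator $\mathsf E_x$ on $\mathcal C$ satisfying $c\le\mathsf E_xc$; $\mathsf E_x(c\sqcap\mathsf E_xd)=\mathsf E_xc\sqcap\mathsf E_xd$; $\mathsf E_x\mathsf E_yc=\mathsf E_y\mathsf E_xc$; $\mathsf E_x(\bigsqcup C)=\bigsqcup_{c\in C}\mathsf E_xc$; $\mathsf E_x(c\Cap\mathsf E_xd)=\mathsf E_xc\Cap\mathsf E_xd$. Derived commands. $\mathbf{guar}\,g=(\pi(g)\sqcup\boldsymbol\epsilon)^\omega$; $\mathbf{demand}\,r=(\epsilon(r)\sqcup\boldsymbol\pi)^\omega$; $\mathbf{term}=\boldsymbol\alpha^\star;\boldsymbol\epsilon^\omega$; $\mathbf{idle}=\mathbf{term}\Cap\mathbf{guar}\,\mathrm{id}$. Known properties of the algebra: $\mathbf{guar}\,g_1\Cap\mathbf{guar}\,g_2=\mathbf{guar}(g_1\cap g_2)$; $\mathbf{guar}\,g\Cap(c;d)=(\mathbf{guar}\,g\Cap c);(\mathbf{guar}\,g\Cap d)$. Local blocks. $(\mathbf{local}\,x\cdot c)=\mathsf E_x(\mathbf{demand}\,\mathrm{id}(x)\Cap c)\Cap\mathbf{guar}\,\mathrm{id}(x)$ and $(\mathbf{var}\,x\cdot c)=\mathbf{idle};(\mathbf{local}\,x\cdot c);\mathbf{idle}$. -}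

module Defs where

open import Level using (Level; suc)
open import Algebra.Definitions using (Congruent₁)
open import Algebra.Structures using (IsMonoid; IsIdempotentCommutativeMonoid)
open import Data.Maybe.Base using (Maybe)
open import Data.Product.Base using (_×_; _,_; ∃; proj₁; proj₂)
open import Function.Definitions using (Congruent; Injective)
open import Relation.Binary.Core using (Rel; _Preserves_⟶_)
open import Relation.Binary.Definitions using (Maximum; Minimum; Monotonic₂; _Respects_)
open import Relation.Binary.Lattice.Structures using (IsDistributiveLattice)
open import Relation.Binary.PropositionalEquality.Core using (_≡_)
open import Relation.Unary using (Pred; _≐_; _∈_; _⊆_; _∩_; ⋃; ⋂; ∁)
open import Relation.Unary.Polymorphic using (U)

-- Arbitrary joins and meets are taken over families indexed by a type in
-- Set ℓ, the universe of the carrier.  A subset P : Pred Carrier ℓ is the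
-- family  proj₁ : ∃ P → Carrier.
record CompleteDistributiveLattice (ℓ : Level) : Set (suc ℓ) where
  infix  4 _≈_ _≤_
  infixr 5 _⊔_
  infixr 6 _⊓_
  field
    Carrier : Set ℓ
    _≈_ _≤_ : Rel Carrier ℓ
    _⊔_ _⊓_ : Carrier → Carrier → Carrier
    ⊥ ⊤     : Carrier
    ⨆ ⋀     : {I : Set ℓ} → (I → Carrier) → Carrier
    isDistributiveLattice : IsDistributiveLattice _≈_ _≤_ _⊔_ _⊓_
    minimum    : Minimum _≤_ ⊥
    maximum    : Maximum _≤_ ⊤
    ⨆-upper    : ∀ {I} (f : I → Carrier) i → f i ≤ ⨆ f
    ⨆-least    : ∀ {I} (f : I → Carrier) {b} → (∀ i → f i ≤ b) → ⨆ f ≤ b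
    ⋀-lower    : ∀ {I} (f : I → Carrier) i → ⋀ f ≤ f i
    ⋀-greatest : ∀ {I} (f : I → Carrier) {b} → (∀ i → b ≤ f i) → b ≤ ⋀ f

  open IsDistributiveLattice isDistributiveLattice public

  IsLeastFixedPoint : (Carrier → Carrier) → Carrier → Set ℓ
  IsLeastFixedPoint f a = (f a ≈ a) × (∀ b → f b ≈ b → a ≤ b)

  IsGreatestFixedPoint : (Carrier → Carrier) → Carrier → Set ℓ
  IsGreatestFixedPoint f a = (f a ≈ a) × (∀ b → f b ≈ b → b ≤ a)

  -- Knaster–Tarski.
  μ ν : (Carrier → Carrier) → Carrier
  μ f = ⋀ {∃ λ y → f y ≤ y} proj₁
  ν f = ⨆ {∃ λ y → y ≤ f y} proj₁

  μ-isLeastFixedPoint : ∀ {f} → f Preserves _≤_ ⟶ _≤_ → IsLeastFixedPoint f (μ f)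
  μ-isLeastFixedPoint {f} mono =
    antisym pre (⋀-lower proj₁ (f (μ f) , mono pre)) ,
    λ b fb≈b → ⋀-lower proj₁ (b , reflexive fb≈b)
    where
    pre : f (μ f) ≤ μ f
    pre = ⋀-greatest proj₁ λ (y , fy≤y) → trans (mono (⋀-lower proj₁ (y , fy≤y))) fy≤y

  ν-isGreatestFixedPoint : ∀ {f} → f Preserves _≤_ ⟶ _≤_ → IsGreatestFixedPoint f (ν f)
  ν-isGreatestFixedPoint {f} mono =
    antisym (⨆-upper proj₁ (f (ν f) , mono post)) post ,
    λ b fb≈b → ⨆-upper proj₁ (b , reflexive (Eq.sym fb≈b))
    where
    post : ν f ≤ f (ν f)
    post = ⨆-least proj₁ λ (y , y≤fy) → trans y≤fy (mono (⨆-upper proj₁ (y , y≤fy)))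

  IsComplement : (t a b : Carrier) → Set ℓ
  IsComplement t a b = (a ⊓ b ≈ ⊥) × (a ⊔ b ≈ t)

  -- The unit t of a sub-algebra need not be ⊤; its zero is ⊥, the empty join.
  -- Meets in the sub-algebra are meets below t: for a nonempty family
  -- t ⊓ ⋀ f is ⋀ f, and for the empty family it is t.
  record IsCompleteBooleanSubalgebra {p} (P : Pred Carrier p) (t : Carrier)
         : Set (suc ℓ Level.⊔ p) where
    field
      respects   : P Respects _≈_
      unit       : t ∈ P
      below-unit : ∀ {a} → a ∈ P → a ≤ t
      ⨆-closed   : ∀ {I : Set ℓ} (f : I → Carrier) → (∀ i → f i ∈ P) → ⨆ f ∈ P
      ⋀-closed   : ∀ {I : Set ℓ} (f : I → Carrier) → (∀ i → f i ∈ P) → t ⊓ ⋀ f ∈ P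
      complement : ∀ {a} → a ∈ P → ∃ λ b → b ∈ P × IsComplement t a b

  -- h embeds the complete Boolean algebra of subsets of X in A; the image is a
  -- complete Boolean sub-algebra with unit h U.
  record IsBooleanEmbedding {X : Set ℓ} {p} (A : Pred Carrier p)
         (h : Pred X ℓ → Carrier) : Set (suc ℓ Level.⊔ p) where
    image : Pred Carrier (suc ℓ)
    image c = ∃ λ r → c ≈ h r

    field
      cong             : Congruent _≐_ _≈_ h
      injective        : Injective _≐_ _≈_ h
      image⊆A          : image ⊆ A
      image-subalgebra : IsCompleteBooleanSubalgebra image (h U)
      ⋃-homo           : ∀ {I : Set ℓ} (R : I → Pred X ℓ) → h (⋃ I R) ≈ ⨆ (λ i → h (R i))
      ⋂-homo           : ∀ {I : Set ℓ} (R : I → Pred X ℓ) → h (⋂ I R) ≈ h U ⊓ ⋀ (λ i → h (R i))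
      ∁-homo           : ∀ r → IsComplement (h U) (h r) (h (∁ r))

module _ {ℓ : Level} (V S : Set ℓ) where

  -- Partial functions V ⇀ S.
  State : Set ℓ
  State = V → Maybe S

  StateRel : Set (suc ℓ)
  StateRel = Pred (State × State) ℓ

module _ {ℓ : Level} {V S : Set ℓ} where

  id : StateRel V S
  id (σ , σ′) = σ ≡ σ′

  id[_] : V → StateRel V S
  id[ x ] (σ , σ′) = σ x ≡ σ′ x

-- Sequential composition is written _⨾_.
record SequentialAlgebra (ℓ : Level) : Set (suc ℓ) where
  infixr 8 _⨾_
  infix  9 _⋆ _^ω
  field
    lattice : CompleteDistributiveLattice ℓ

  open CompleteDistributiveLattice lattice public renaming (Carrier to Command)

  field
    nil        : Command
    _⨾_        : Command → Command → Command
    ⨾-isMonoid : IsMonoid _≈_ _⨾_ nil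
    ⨾-mono     : Monotonic₂ _≤_ _≤_ _≤_ _⨾_

  _⋆ _^ω : Command → Command
  c ⋆  = μ (λ y → nil ⊔ c ⨾ y)
  c ^ω = ν (λ y → nil ⊔ c ⨾ y)

  private
    unfold-mono : ∀ c → (λ y → nil ⊔ c ⨾ y) Preserves _≤_ ⟶ _≤_
    unfold-mono c {y} {z} y≤z =
      ∨-least (x≤x∨y nil (c ⨾ z)) (trans (⨾-mono refl y≤z) (y≤x∨y nil (c ⨾ z)))

  ⋆-isLeastFixedPoint : ∀ c → IsLeastFixedPoint (λ y → nil ⊔ c ⨾ y) (c ⋆)
  ⋆-isLeastFixedPoint c = μ-isLeastFixedPoint (unfold-mono c)

  ω-isGreatestFixedPoint : ∀ c → IsGreatestFixedPoint (λ y → nil ⊔ c ⨾ y) (c ^ω)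
  ω-isGreatestFixedPoint c = ν-isGreatestFixedPoint (unfold-mono c)

-- Variables in V, values in S.
record CommandAlgebra {ℓ : Level} (V S : Set ℓ) : Set (suc ℓ) where
  infixr 7 _⋒_
  field
    sequentialAlgebra : SequentialAlgebra ℓ

  open SequentialAlgebra sequentialAlgebra public

  field
    𝒜            : Pred Command ℓ
    ⊤𝒜           : Command
    𝒜-subalgebra : IsCompleteBooleanSubalgebra 𝒜 ⊤𝒜
    π ε          : StateRel V S → Command
    π-embedding  : IsBooleanEmbedding 𝒜 π
    ε-embedding  : IsBooleanEmbedding 𝒜 ε

  𝝅 : Command
  𝝅 = π U

  𝝐 : Command
  𝝐 = ε U

  𝜶 : Command
  𝜶 = 𝝅 ⊔ 𝝐

  chaos : Command
  chaos = 𝜶 ^ω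

  guar : StateRel V S → Command
  guar g = (π g ⊔ 𝝐) ^ω

  demand : StateRel V S → Command
  demand r = (ε r ⊔ 𝝅) ^ω

  term : Command
  term = 𝜶 ⋆ ⨾ 𝝐 ^ω

  field
    𝝅𝝐-complementary : IsComplement ⊤𝒜 𝝅 𝝐
    _⋒_    : Command → Command → Command
    ⋒-mono : Monotonic₂ _≤_ _≤_ _≤_ _⋒_
    ⋒-isIdempotentCommutativeMonoid : IsIdempotentCommutativeMonoid _≈_ _⋒_ chaos

    E           : V → Command → Command
    E-cong      : ∀ x → Congruent₁ _≈_ (E x)
    E-extensive : ∀ x c → c ≤ E x c
    E-⊓         : ∀ x c d → E x (c ⊓ E x d) ≈ E x c ⊓ E x d
    E-comm      : ∀ x y c → E x (E y c) ≈ E y (E x c)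
    E-⨆         : ∀ x {I : Set ℓ} (f : I → Command) → E x (⨆ f) ≈ ⨆ (λ i → E x (f i))
    E-⋒         : ∀ x c d → E x (c ⋒ E x d) ≈ E x c ⋒ E x d

    guar-⋒      : ∀ g₁ g₂ → guar g₁ ⋒ guar g₂ ≈ guar (g₁ ∩ g₂)
    guar-⋒-⨾    : ∀ g c d → guar g ⋒ (c ⨾ d) ≈ (guar g ⋒ c) ⨾ (guar g ⋒ d)

  idle : Command
  idle = term ⋒ guar id

  local var : V → Command → Command
  local x c = E x (demand id[ x ] ⋒ c) ⋒ guar id[ x ]
  var x c   = idle ⨾ local x c ⨾ idle

{-# OPTIONS --safe #-}
module Submission where

open import Defs
open import Data.Nat.Base using (ℕ)
open import Function.Bundles using (_↣_)
open import Level using (Level)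
open import Algebra.Structures using (IsMonoid; IsIdempotentCommutativeMonoid)
open import Data.Product.Base using (_,_; proj₁; proj₂)
open import Relation.Binary.Bundles using (Setoid)
open import Relation.Binary.PropositionalEquality.Core using (cong)
open import Relation.Unary using (_≐_; _⊆_; _∩_)
import Relation.Binary.Reasoning.Setoid as SetoidReasoning

-- The commands c with c ⋒ guar g ≈ c are closed under ⨾, because guar g
-- distributes over ⨾.  They include idle for g = id[ x ], since id ⊆ id[ x ], and
-- local x c, since ⋒ is idempotent.

-- `var x c` is a sequential composition of three commands, so it suffices that each factor absorbs
-- `guar id[ x ]`; `guarantees-⨾` carries absorption over to the composite. The block `local x c`
-- already has this guarantee as a conjunct, while `idle` has the stronger `guar id`, which absorbs
-- the weaker one by `guarantees-⋒`.

module SequentialProperties {ℓ : Level} (𝒮 : SequentialAlgebra ℓ) where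
  open SequentialAlgebra 𝒮

  ⊔-monoˡ : ∀ {a b} c → a ≤ b → a ⊔ c ≤ b ⊔ c
  ⊔-monoˡ {a} {b} c a≤b = ∨-least (trans a≤b (x≤x∨y b c)) (y≤x∨y b c)

  -- Every post-fixed point of the unfolding of `a` is one for `b`, and `^ω` is the join of these.
  ω-mono : ∀ {a b} → a ≤ b → a ^ω ≤ b ^ω
  ω-mono {a} {b} a≤b = ⨆-least proj₁ λ (y , y≤) → ⨆-upper proj₁
    (y , trans y≤ (∨-least (x≤x∨y nil (b ⨾ y))
                           (trans (⨾-mono a≤b refl) (y≤x∨y nil (b ⨾ y)))))

module CommandProperties {ℓ : Level} {V S : Set ℓ} (𝒞 : CommandAlgebra V S) where
  open CommandAlgebra 𝒞
  open SequentialProperties sequentialAlgebra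
  open IsBooleanEmbedding π-embedding using () renaming (cong to π-cong)
  open IsMonoid ⨾-isMonoid using () renaming (∙-cong to ⨾-cong)
  open IsIdempotentCommutativeMonoid ⋒-isIdempotentCommutativeMonoid using ()
    renaming (∙-congˡ to ⋒-congˡ; assoc to ⋒-assoc; comm to ⋒-comm; idem to ⋒-idem)

  ≈-setoid : Setoid ℓ ℓ
  ≈-setoid = record { isEquivalence = isEquivalence }

  open SetoidReasoning ≈-setoid

  -- Needed because `g ∩ h` and `g` are only extensionally equal when `g ⊆ h`.
  guar-cong : ∀ {g h} → g ≐ h → guar g ≈ guar h
  guar-cong g≐h = antisym
    (ω-mono (⊔-monoˡ 𝝐 (reflexive (π-cong g≐h))))
    (ω-mono (⊔-monoˡ 𝝐 (reflexive (Eq.sym (π-cong g≐h)))))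

  Guarantees : StateRel V S → Command → Set ℓ
  Guarantees g c = c ⋒ guar g ≈ c

  -- Conjoined guarantees intersect their relations, and `g ∩ h` collapses to `g`.
  guarantees-⋒ : ∀ {g h} c → g ⊆ h → Guarantees h (c ⋒ guar g)
  guarantees-⋒ {g} {h} c g⊆h = begin
    (c ⋒ guar g) ⋒ guar h  ≈⟨ ⋒-assoc c (guar g) (guar h) ⟩
    c ⋒ guar g ⋒ guar h    ≈⟨ ⋒-congˡ (guar-⋒ g h) ⟩
    c ⋒ guar (g ∩ h)       ≈⟨ ⋒-congˡ (guar-cong (proj₁ , λ r → r , g⊆h r)) ⟩
    c ⋒ guar g             ∎

  guarantees-⨾ : ∀ {g c d} → Guarantees g c → Guarantees g d → Guarantees g (c ⨾ d)
  guarantees-⨾ {g} {c} {d} gc gd = begin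
    (c ⨾ d) ⋒ guar g               ≈⟨ ⋒-comm (c ⨾ d) (guar g) ⟩
    guar g ⋒ (c ⨾ d)               ≈⟨ guar-⋒-⨾ g c d ⟩
    (guar g ⋒ c) ⨾ (guar g ⋒ d)    ≈⟨ ⨾-cong (⋒-comm (guar g) c) (⋒-comm (guar g) d) ⟩
    (c ⋒ guar g) ⨾ (d ⋒ guar g)    ≈⟨ ⨾-cong gc gd ⟩
    c ⨾ d                          ∎

  idle-guarantees : ∀ x → Guarantees id[ x ] idle
  -- Evaluating equal states at `x` gives `id ⊆ id[ x ]`.
  idle-guarantees x = guarantees-⋒ term (cong λ σ → σ x)

  local-guarantees : ∀ x c → Guarantees id[ x ] (local x c)
  local-guarantees x c =
    Eq.trans (⋒-assoc _ _ _) (⋒-congˡ (⋒-idem (guar id[ x ])))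

  var-guarantees : ∀ x c → Guarantees id[ x ] (var x c)
  var-guarantees x c =
    guarantees-⨾ (idle-guarantees x) (guarantees-⨾ (local-guarantees x c) (idle-guarantees x))

mainTheorem7 : ∀ {ℓ} (V S : Set ℓ) → V ↣ ℕ → (𝒞 : CommandAlgebra V S) →
    let open CommandAlgebra 𝒞 in
    ∀ (x : V) (c : Command) → var x c ≈ var x c ⋒ guar id[ x ]
mainTheorem7 V S _ 𝒞 x c = Eq.sym (var-guarantees x c)
  where
  open CommandAlgebra 𝒞 using (module Eq)
  open CommandProperties 𝒞
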